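{- Let $n\geq 4$ be an integer divisible by $2$ or by $3$. Then $t(n)\leq n-3$.
   Context: For a positive integer $n$ let $S(\mathbb{Z}_n)$ be the set of bijections $\mathbb{Z}_n\to\mathbb{Z}_n$ (identified with $S_n$). For $\pi\in S(\mathbb{Z}_n)$, $\mathrm{cyc}(\pi)$ is the number of cycles (including fixed points) in its cycle decomposition, and $t(\pi)=n-\mathrm{cyc}(\pi)$ is the minimum number of transpositions whose product is $\pi$. The circular class of $\pi$ is $[\pi]=\{x\mapsto \pi(x+b): b\in\mathbb{Z}_n\}$, $t([\pi])=\min_{\sigma\in[\pi]}t(\sigma)$, and $t(n)=\max_{\pi\in S(\mathbb{Z}_n)}t([\pi])$. -}

module Defs where

open import Data.Nat.Base using (ℕ; zero; suc; _+_; _*_; _∸_; _≤_; _<_; NonZero; >-nonZero)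
open import Data.Nat.DivMod using (_%_; _/_; _mod_; m%n<n; m≡m%n+[m/n]*n; m<n⇒m%n≡m; %-distribˡ-+; [m+n]%n≡m%n; m%n%n≡m%n)
open import Data.Nat.Properties using (+-assoc; m+[n∸m]≡n; m∸n+n≡m; m∸n≤m; m<n⇒0<n∸m; n<1+n; <⇒≤; ≤-trans; <-≤-trans; ≤-reflexive)
open import Data.Fin.Base using (Fin; zero; suc; toℕ; fromℕ<; punchIn)
open import Data.Fin.Properties as Fin using (toℕ<n; toℕ≤pred[n]; toℕ-fromℕ<; toℕ-injective; pigeonhole; any?)
open import Data.Fin.Permutation using (Permutation′; permutation; _⟨$⟩ʳ_; _≈_; _∘ₚ_; id; insert; remove; insert-remove)
open import Data.List.Base using (List; []; _∷_; [_]; length; map; filter; deduplicate; allFin; cartesianProductWith)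
open import Data.List.Extrema.Nat using (min; max; v≤max⁺)
open import Data.List.Membership.Propositional.Properties using (∈-allFin)
open import Data.List.Properties using (filter-≐; map-cong; map-∘)
open import Data.List.Relation.Unary.Any as Any using (Any; here)
open import Data.List.Relation.Unary.Any.Properties using (map⁺; cartesianProductWith⁺)
open import Data.Product.Base using (∃-syntax; _×_; _,_)
open import Data.Sum.Base using (inj₂)
open import Function.Base using (_∘_)
open import Function.Bundles using (Injection)
import Function.Endo.Propositional as Endo
open import Function.Properties.Inverse using (↔⇒↣)
open import Relation.Binary.Definitions using (Decidable)
open import Relation.Binary.PropositionalEquality using (_≡_; refl; sym; trans; cong; cong₂; module ≡-Reasoning)
open import Relation.Nullary.Decidable using (yes; no; map′; ¬?)

private
  variable
    n : ℕ

-- ℤₙ is Fin n with addition modulo n.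

infixl 6 _⊕_

_⊕_ : .{{_ : NonZero n}} → Fin n → Fin n → Fin n
_⊕_ {n} x b = (toℕ x + toℕ b) mod n

private
  toℕ-mod : ∀ m n .{{_ : NonZero n}} → toℕ (m mod n) ≡ m % n
  toℕ-mod m n = toℕ-fromℕ< (m%n<n m n)

  mod-cancel : ∀ n .{{_ : NonZero n}} (x : Fin n) c d → c + d ≡ n →
               (toℕ ((toℕ x + c) mod n) + d) mod n ≡ x
  mod-cancel n x c d c+d≡n = toℕ-injective (begin
    toℕ ((toℕ ((toℕ x + c) mod n) + d) mod n)  ≡⟨ toℕ-mod _ n ⟩
    (toℕ ((toℕ x + c) mod n) + d) % n          ≡⟨ cong (λ y → (y + d) % n) (toℕ-mod _ n) ⟩
    ((toℕ x + c) % n + d) % n                  ≡⟨ %-distribˡ-+ ((toℕ x + c) % n) d n ⟩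
    ((toℕ x + c) % n % n + d % n) % n          ≡⟨ cong (λ y → (y + d % n) % n) (m%n%n≡m%n (toℕ x + c) n) ⟩
    ((toℕ x + c) % n + d % n) % n              ≡⟨ %-distribˡ-+ (toℕ x + c) d n ⟨
    (toℕ x + c + d) % n                        ≡⟨ cong (_% n) (+-assoc (toℕ x) c d) ⟩
    (toℕ x + (c + d)) % n                      ≡⟨ cong (λ y → (toℕ x + y) % n) c+d≡n ⟩
    (toℕ x + n) % n                            ≡⟨ [m+n]%n≡m%n (toℕ x) n ⟩
    toℕ x % n                                  ≡⟨ m<n⇒m%n≡m (toℕ<n x) ⟩
    toℕ x                                      ∎)
    where open ≡-Reasoning

rotation : .{{_ : NonZero n}} → Fin n → Permutation′ n
rotation {n} b = permutation (_⊕ b) (λ x → (toℕ x + (n ∸ toℕ b)) mod n)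
  (λ x → mod-cancel n x (n ∸ toℕ b) (toℕ b) (m∸n+n≡m (<⇒≤ (toℕ<n b))))
  (λ x → mod-cancel n x (toℕ b) (n ∸ toℕ b) (m+[n∸m]≡n (<⇒≤ (toℕ<n b))))

power : Permutation′ n → ℕ → Fin n → Fin n
power {n} π k = (π ⟨$⟩ʳ_) ^ k
  where open Endo (Fin n) using (_^_)

-- For permutations of a finite set, nonnegative powers suffice to make this an
-- equivalence relation; its classes are the cycles, fixed points included.

SameCycle : Permutation′ n → Fin n → Fin n → Set
SameCycle π i j = ∃[ k ] power π k i ≡ j

private
  power-+ : ∀ (π : Permutation′ n) k l i → power π (k + l) i ≡ power π k (power π l i)
  power-+ π zero    l i = refl
  power-+ π (suc k) l i = cong (π ⟨$⟩ʳ_) (power-+ π k l i)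

  power-injective : ∀ (π : Permutation′ n) k {i j} → power π k i ≡ power π k j → i ≡ j
  power-injective π zero    eq = eq
  power-injective π (suc k) eq = power-injective π k (Injection.injective (↔⇒↣ π) eq)

  power-* : ∀ (π : Permutation′ n) p {i} → power π p i ≡ i → ∀ q → power π (q * p) i ≡ i
  power-* π p eq zero    = refl
  power-* π p eq (suc q) = trans (power-+ π p (q * p) _) (trans (cong (power π p) (power-* π p eq q)) eq)

  period : ∀ (π : Permutation′ n) i → ∃[ p ] 0 < p × p ≤ n × power π p i ≡ i
  period {n} π i with pigeonhole (n<1+n n) (λ k → power π (toℕ k) i)
  ... | a , b , a<b , eq =
    toℕ b ∸ toℕ a , m<n⇒0<n∸m a<b , ≤-trans (m∸n≤m (toℕ b) (toℕ a)) (toℕ≤pred[n] b) ,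
    power-injective π (toℕ a)
      (trans (sym (power-+ π (toℕ a) (toℕ b ∸ toℕ a) i))
        (trans (cong (λ k → power π k i) (m+[n∸m]≡n (<⇒≤ a<b))) (sym eq)))

  bounded : ∀ (π : Permutation′ n) {i j} → SameCycle π i j → ∃[ k ] power π (toℕ {n} k) i ≡ j
  bounded {n} π {i} {j} (k , eq) with period π i
  ... | p , 0<p , p≤n , per = fromℕ< k%p<n , (begin
    power π (toℕ (fromℕ< k%p<n)) i             ≡⟨ cong (λ l → power π l i) (toℕ-fromℕ< k%p<n) ⟩
    power π (k % p) i                          ≡⟨ cong (power π (k % p)) (power-* π p per (k / p)) ⟨
    power π (k % p) (power π (k / p * p) i)    ≡⟨ power-+ π (k % p) (k / p * p) i ⟨
    power π (k % p + k / p * p) i              ≡⟨ cong (λ l → power π l i) (m≡m%n+[m/n]*n k p) ⟨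
    power π k i                                ≡⟨ eq ⟩
    j                                          ∎)
    where
    open ≡-Reasoning
    instance
      p≢0 : NonZero p
      p≢0 = >-nonZero 0<p
    k%p<n : k % p < n
    k%p<n = <-≤-trans (m%n<n k p) p≤n

sameCycle? : (π : Permutation′ n) → Decidable (SameCycle π)
sameCycle? {n} π i j =
  map′ (λ (k , eq) → toℕ k , eq) (bounded π) (any? (λ (k : Fin n) → power π (toℕ k) i Fin.≟ j))

cyc : Permutation′ n → ℕ
cyc {n} π = length (deduplicate (sameCycle? π) (allFin n))

tₚ : Permutation′ n → ℕ
tₚ {n} π = n ∸ cyc π

-- _∘ₚ_ applies its left argument first, so the members are x ↦ π (x ⊕ b).

circularClass : .{{_ : NonZero n}} → Permutation′ n → List (Permutation′ n)
circularClass {n} π = map (λ b → rotation b ∘ₚ π) (allFin n)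

-- The first argument of min is its value on the empty list; π is itself in its
-- class (b = 0), so including it does not change the minimum.

t[_] : .{{_ : NonZero n}} → Permutation′ n → ℕ
t[ π ] = min (tₚ π) (map tₚ (circularClass π))

-- Every permutation of Fin n, each once up to _≈_ (see permutations-complete):
-- choose the image of 0, then a permutation of the remaining elements.

permutations : ∀ n → List (Permutation′ n)
permutations zero    = [ id ]
permutations (suc n) = cartesianProductWith (insert zero) (allFin (suc n)) (permutations n)

t : ∀ n .{{_ : NonZero n}} → ℕ
t n = max 0 (map t[_] (permutations n))

permutations-complete : (π : Permutation′ n) → Any (_≈ π) (permutations n)
permutations-complete {zero}  π = here λ ()
permutations-complete {suc n} π = cartesianProductWith⁺ (insert zero)
  (λ { {y = ρ} refl ρ≈ k → trans (insert-cong zero (π ⟨$⟩ʳ zero) {ρ} {remove zero π} ρ≈ k) (insert-remove zero π k) })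
  (∈-allFin (π ⟨$⟩ʳ zero))
  (permutations-complete (remove zero π))
  where
  insert-cong : ∀ i j {ρ σ : Permutation′ n} → ρ ≈ σ → insert i j ρ ≈ insert i j σ
  insert-cong i j eq k with i Fin.≟ k
  ... | yes _ = refl
  ... | no  _ = cong (punchIn j) (eq _)

private
  SameCycle-resp : ∀ {π ρ : Permutation′ n} → π ≈ ρ → ∀ {i j} → SameCycle π i j → SameCycle ρ i j
  SameCycle-resp {π = π} {ρ} eq (k , p) = k , trans (sym (power-cong k _)) p
    where
    power-cong : ∀ k i → power π k i ≡ power ρ k i
    power-cong zero    i = refl
    power-cong (suc k) i = trans (eq _) (cong (ρ ⟨$⟩ʳ_) (power-cong k i))

tₚ-cong : {π ρ : Permutation′ n} → π ≈ ρ → tₚ π ≡ tₚ ρ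
tₚ-cong {n} {π} {ρ} eq = cong (λ xs → n ∸ length xs) (dedup-cong (allFin n))
  where
  dedup-cong : ∀ xs → deduplicate (sameCycle? π) xs ≡ deduplicate (sameCycle? ρ) xs
  dedup-cong []       = refl
  dedup-cong (x ∷ xs) = cong (x ∷_) (trans
    (filter-≐ (¬? ∘ sameCycle? π x) (¬? ∘ sameCycle? ρ x)
      ( (λ ¬p q → ¬p (SameCycle-resp {π = ρ} {π} (λ i → sym (eq i)) q))
      , (λ ¬p q → ¬p (SameCycle-resp {π = π} {ρ} eq q)))
      (deduplicate (sameCycle? π) xs))
    (cong (filter (¬? ∘ sameCycle? ρ x)) (dedup-cong xs)))

t[]-cong : .{{_ : NonZero n}} {π ρ : Permutation′ n} → π ≈ ρ → t[ π ] ≡ t[ ρ ]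
t[]-cong {n} {π} {ρ} eq = cong₂ min (tₚ-cong {π = π} {ρ} eq) (begin
  map tₚ (circularClass π)                       ≡⟨ map-∘ (allFin n) ⟨
  map (λ b → tₚ (rotation b ∘ₚ π)) (allFin n)    ≡⟨ map-cong (λ b → tₚ-cong {π = rotation b ∘ₚ π} {rotation b ∘ₚ ρ} (λ i → eq _)) (allFin n) ⟩
  map (λ b → tₚ (rotation b ∘ₚ ρ)) (allFin n)    ≡⟨ map-∘ (allFin n) ⟩
  map tₚ (circularClass ρ)                       ∎)
  where open ≡-Reasoning

t[]≤t : .{{_ : NonZero n}} (π : Permutation′ n) → t[ π ] ≤ t n
t[]≤t {n} π = v≤max⁺ 0 _ (inj₂ (map⁺
  (Any.map (λ {ρ} ρ≈π → ≤-reflexive (sym (t[]-cong {π = ρ} {π} ρ≈π))) (permutations-complete π))))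

{-# OPTIONS --safe #-}
-- Write d y = y − π y and s y = y + π y.  If d y = d y′ = b for y ≠ y′, then
-- x ↦ π (x + b) fixes π y and π y′, so it has at least three cycles when n ≥ 4.
-- Otherwise d is a bijection, and every x ↦ π (x + b) has a fixed point.  If then
-- s y = s y′ for y ≠ y′, the map x ↦ π (x + b) with b = y′ − π y swaps π y and
-- π y′, and again there are three cycles.  If d and s are both bijections, then
-- summing d gives n ∣ ∑ i, which fails for even n, and summing d² + s² = 2y² + 2(πy)²
-- gives n ∣ 2 ∑ i², which fails when 3 ∣ n (Pólya's argument for toroidal queens).
module Submission where

open import Defs
open import Data.Nat.Base using (ℕ; NonZero; _≤_; _∸_)
open import Data.Nat.Divisibility using (_∣_)
open import Data.Sum.Base using (_⊎_)

open import Data.Nat.Base using (zero; suc; _+_; _*_; _<_; z≤n)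
open import Data.Nat.DivMod using (_%_; _/_; _mod_; m%n<n; m≡m%n+[m/n]*n; %-distribˡ-+; m%n%n≡m%n)
open import Data.Nat.Properties using (+-comm; +-assoc; ∸-monoʳ-≤; <⇒≱; 1+n≰n)
open import Data.Nat.Divisibility using (_∣?_)
open import Data.Fin.Base using (Fin; zero; suc; toℕ; punchOut)
open import Data.Fin.Patterns using (0F; 1F; 2F)
open import Data.Fin.Permutation using (Permutation′; permutation; _⟨$⟩ʳ_; _⟨$⟩ˡ_; _∘ₚ_; inverseʳ)
open import Data.Fin.Properties using (_≟_; any?; toℕ-fromℕ<; toℕ-injective; toℕ-inject₁; toℕ-fromℕ; injective⇒≤; punchOut-injective)
open import Data.Integer.Base as ℤ using (ℤ; +_)
open import Data.Integer.Divisibility.Signed as ℤ using (divides)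
import Data.Integer.Properties as ℤ
open import Data.Integer.Tactic.RingSolver using (solve-∀)
open import Data.List.Base using (allFin; deduplicate; lookup)
open import Data.List.Extrema.Nat using (min≤v⁺; max≤v⁺)
open import Data.List.Membership.Propositional using (lose)
open import Data.List.Membership.Propositional.Properties using (∈-allFin)
open import Data.List.Relation.Unary.All using (universal)
import Data.List.Relation.Unary.All.Properties as All
open import Data.List.Relation.Unary.Any as Any using (Any)
import Data.List.Relation.Unary.Any.Properties as Any
open import Data.Product.Base using (∃-syntax; ∃₂; _×_; _,_; proj₁; proj₂)
open import Data.Sum.Base using (inj₁; inj₂; [_,_])
open import Data.Vec.Base as Vec using ([]; _∷_)
open import Function.Base using (_∘_; case_of_)
open import Function.Bundles using (Injection)
open import Function.Definitions using (Injective; StrictlySurjective)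
open import Function.Properties.Inverse using (↔⇒↣)
open import Relation.Binary.PropositionalEquality using (_≡_; _≢_; refl; sym; trans; cong; cong₂; subst; module ≡-Reasoning)
open import Relation.Nullary using (¬_; yes; no; contradiction)
open import Relation.Nullary.Decidable using (¬?; _×-dec_; decidable-stable; from-no)
open import Algebra.Properties.Semiring.Sum ℤ.+-*-semiring using (sum; sum-syntax; sum-cong-≗; sum-init-last; ∑-distrib-+; ∑-permute)

private
  variable
    k m n : ℕ

-- Maps between finite sets

injective-or-collision : (f : Fin m → Fin n) →
                         Injective _≡_ _≡_ f ⊎ ∃₂ λ i j → i ≢ j × f i ≡ f j
injective-or-collision f with any? (λ i → any? (λ j → ¬? (i ≟ j) ×-dec (f i ≟ f j)))
... | yes collision   = inj₂ collision
... | no  ¬collision = inj₁ λ {i} {j} fi≡fj →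
  decidable-stable (i ≟ j) (λ i≢j → ¬collision (i , j , i≢j , fi≡fj))

-- If `y` were missed, punching it out of the codomain would inject `Fin (suc n)` into `Fin n`.
injective⇒surjective : {f : Fin n → Fin n} → Injective _≡_ _≡_ f → StrictlySurjective _≡_ f
injective⇒surjective {suc n} {f} inj y with any? (λ x → f x ≟ y)
... | yes hit  = hit
... | no  miss = contradiction (injective⇒≤ inj′) 1+n≰n
  where
  y≢f : ∀ x → y ≢ f x
  y≢f x y≡fx = miss (x , sym y≡fx)
  inj′ : Injective _≡_ _≡_ (λ x → punchOut (y≢f x))
  inj′ {i} {j} eq = inj (punchOut-injective (y≢f i) (y≢f j) eq)

injective⇒permutation : (f : Fin n → Fin n) → Injective _≡_ _≡_ f → Permutation′ n
injective⇒permutation f inj = permutation f (proj₁ ∘ surj) (proj₂ ∘ surj) (λ x → inj (proj₂ (surj (f x))))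
  where surj = injective⇒surjective inj

-- If every point were hit, a choice of preimages would inject `Fin n` into `Fin m`.
<⇒missed-point : m < n → (f : Fin m → Fin n) → ∃[ y ] (∀ x → f x ≢ y)
<⇒missed-point m<n f with any? (λ y → ¬? (any? (λ x → f x ≟ y)))
... | yes (y , miss) = y , λ x fx≡y → miss (x , fx≡y)
... | no  ¬missed    = contradiction (injective⇒≤ section-injective) (<⇒≱ m<n)
  where
  hit : ∀ y → ∃[ x ] f x ≡ y
  hit y = decidable-stable (any? (λ x → f x ≟ y)) (λ miss → ¬missed (y , miss))
  section-injective : Injective _≡_ _≡_ (proj₁ ∘ hit)
  section-injective {y} {z} eq = trans (sym (proj₂ (hit y))) (trans (cong f eq) (proj₂ (hit z)))

⟨$⟩ʳ-injective : (π : Permutation′ n) → Injective _≡_ _≡_ (π ⟨$⟩ʳ_)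
⟨$⟩ʳ-injective π = Injection.injective (↔⇒↣ π)

-- Lower bounds on the number of cycles

-- An invariant colouring is constant on each cycle, so every colour already occurs among the cycle
-- representatives kept by `deduplicate`, and different colours occur at different positions.
invariant⇒≤cyc : (π : Permutation′ n) (c : Fin n → Fin k) →
                 (∀ x → c (π ⟨$⟩ʳ x) ≡ c x) → StrictlySurjective _≡_ c → k ≤ cyc π
invariant⇒≤cyc {n} {k} π c inv surj = injective⇒≤ index-injective
  where
  c-power : ∀ l x → c (power π l x) ≡ c x
  c-power zero    x = refl
  c-power (suc l) x = trans (inv _) (c-power l x)

  cycles = deduplicate (sameCycle? π) (allFin n)

  representative : ∀ i → Any (λ x → c x ≡ i) cycles
  representative i = Any.deduplicate⁺ (sameCycle? π) {xs = allFin n}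
    (λ { {_} {x} (l , refl) cx≡i → trans (sym (c-power l x)) cx≡i })
    (lose (∈-allFin (proj₁ (surj i))) (proj₂ (surj i)))

  index-injective : Injective _≡_ _≡_ (λ i → Any.index (representative i))
  index-injective {i} {j} eq =
    trans (sym (Any.lookup-index (representative i)))
      (trans (cong (λ l → c (lookup cycles l)) eq) (Any.lookup-index (representative j)))

-- The case a ≡ a′ is that of two distinct fixed points a and b.
three-cycles : (π : Permutation′ n) → 4 ≤ n → ∀ {a a′ b} →
               π ⟨$⟩ʳ a ≡ a′ → π ⟨$⟩ʳ a′ ≡ a → π ⟨$⟩ʳ b ≡ b → b ≢ a → b ≢ a′ → 3 ≤ cyc π
three-cycles {n} π 4≤n {a} {a′} {b} πa≡a′ πa′≡a πb≡b b≢a b≢a′ = invariant⇒≤cyc π c c-invariant c-surjective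
  where
  c : Fin n → Fin 3
  c x with x ≟ a | x ≟ a′ | x ≟ b
  ... | yes _ | _     | _     = 0F
  ... | no  _ | yes _ | _     = 0F
  ... | no  _ | no  _ | yes _ = 1F
  ... | no  _ | no  _ | no  _ = 2F

  c[a] : c a ≡ 0F
  c[a] with a ≟ a
  ... | yes _   = refl
  ... | no  a≢a = contradiction refl a≢a

  c[a′] : c a′ ≡ 0F
  c[a′] with a′ ≟ a | a′ ≟ a′
  ... | yes _ | _         = refl
  ... | no  _ | yes _     = refl
  ... | no  _ | no  a′≢a′ = contradiction refl a′≢a′

  c[b] : c b ≡ 1F
  c[b] with b ≟ a | b ≟ a′ | b ≟ b
  ... | yes b≡a | _        | _       = contradiction b≡a b≢a
  ... | no  _   | yes b≡a′ | _       = contradiction b≡a′ b≢a′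
  ... | no  _   | no  _    | yes _   = refl
  ... | no  _   | no  _    | no  b≢b = contradiction refl b≢b

  c[other] : ∀ {x} → x ≢ a → x ≢ a′ → x ≢ b → c x ≡ 2F
  c[other] {x} x≢a x≢a′ x≢b with x ≟ a | x ≟ a′ | x ≟ b
  ... | yes x≡a | _        | _       = contradiction x≡a x≢a
  ... | no  _   | yes x≡a′ | _       = contradiction x≡a′ x≢a′
  ... | no  _   | no  _    | yes x≡b = contradiction x≡b x≢b
  ... | no  _   | no  _    | no  _   = refl

  π-injective : ∀ {x y z} → π ⟨$⟩ʳ y ≡ z → π ⟨$⟩ʳ x ≡ z → x ≡ y
  π-injective πy≡z πx≡z = ⟨$⟩ʳ-injective π (trans πx≡z (sym πy≡z))

  c-invariant : ∀ x → c (π ⟨$⟩ʳ x) ≡ c x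
  c-invariant x = case (x ≟ a) , (x ≟ a′) , (x ≟ b) of λ where
    (yes refl , _ , _)          → trans (cong c πa≡a′) (trans c[a′] (sym c[a]))
    (no _ , yes refl , _)       → trans (cong c πa′≡a) (trans c[a] (sym c[a′]))
    (no _ , no _ , yes refl)    → cong c πb≡b
    -- The complement of `a`, `a′`, `b` is preserved because their only preimages under `π` are
    -- `a′`, `a` and `b`.
    (no x≢a , no x≢a′ , no x≢b) → trans
      (c[other] (x≢a′ ∘ π-injective πa′≡a) (x≢a ∘ π-injective πa≡a′) (x≢b ∘ π-injective πb≡b))
      (sym (c[other] x≢a x≢a′ x≢b))

  c-surjective : StrictlySurjective _≡_ c
  c-surjective 0F = a , c[a]
  c-surjective 1F = b , c[b]
  -- Three points cannot exhaust `Fin n` when `4 ≤ n`.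
  c-surjective 2F with <⇒missed-point 4≤n (Vec.lookup (a ∷ a′ ∷ b ∷ []))
  ... | x , missed = x , c[other] (missed 0F ∘ sym) (missed 1F ∘ sym) (missed 2F ∘ sym)

-- Arithmetic modulo n

module _ .{{_ : NonZero n}} where

  infixl 6 _⊖_

  -- As the inverse of a rotation, subtraction inherits its cancellation law from the permutation.
  _⊖_ : Fin n → Fin n → Fin n
  x ⊖ y = rotation y ⟨$⟩ˡ x

  [x⊖y]⊕y≡x : ∀ x y → (x ⊖ y) ⊕ y ≡ x
  [x⊖y]⊕y≡x x y = inverseʳ (rotation y)

  toℕ-⊕ : (x y : Fin n) → toℕ (x ⊕ y) ≡ (toℕ x + toℕ y) % n
  toℕ-⊕ x y = toℕ-fromℕ< (m%n<n (toℕ x + toℕ y) n)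

  ⊕-comm : (x y : Fin n) → x ⊕ y ≡ y ⊕ x
  ⊕-comm x y = cong (_mod n) (+-comm (toℕ x) (toℕ y))

  [m%n+o]%n≡[m+o]%n : ∀ m o → (m % n + o) % n ≡ (m + o) % n
  [m%n+o]%n≡[m+o]%n m o = begin
    (m % n + o) % n          ≡⟨ %-distribˡ-+ (m % n) o n ⟩
    (m % n % n + o % n) % n  ≡⟨ cong (λ r → (r + o % n) % n) (m%n%n≡m%n m n) ⟩
    (m % n + o % n) % n      ≡⟨ %-distribˡ-+ m o n ⟨
    (m + o) % n              ∎
    where open ≡-Reasoning

  ⊕-rotate : (x y z : Fin n) → x ⊕ y ⊕ z ≡ y ⊕ z ⊕ x
  ⊕-rotate x y z = toℕ-injective (begin
    toℕ (x ⊕ y ⊕ z)                ≡⟨ toℕ-⊕⊕ x y z ⟩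
    (toℕ x + toℕ y + toℕ z) % n    ≡⟨ cong (_% n) (+-assoc (toℕ x) (toℕ y) (toℕ z)) ⟩
    (toℕ x + (toℕ y + toℕ z)) % n  ≡⟨ cong (_% n) (+-comm (toℕ x) (toℕ y + toℕ z)) ⟩
    (toℕ y + toℕ z + toℕ x) % n    ≡⟨ toℕ-⊕⊕ y z x ⟨
    toℕ (y ⊕ z ⊕ x)                ∎)
    where
    open ≡-Reasoning
    toℕ-⊕⊕ : ∀ x y z → toℕ (x ⊕ y ⊕ z) ≡ (toℕ x + toℕ y + toℕ z) % n
    toℕ-⊕⊕ x y z = begin
      toℕ (x ⊕ y ⊕ z)                      ≡⟨ toℕ-⊕ (x ⊕ y) z ⟩
      (toℕ (x ⊕ y) + toℕ z) % n            ≡⟨ cong (λ r → (r + toℕ z) % n) (toℕ-⊕ x y) ⟩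
      ((toℕ x + toℕ y) % n + toℕ z) % n    ≡⟨ [m%n+o]%n≡[m+o]%n (toℕ x + toℕ y) (toℕ z) ⟩
      (toℕ x + toℕ y + toℕ z) % n          ∎

  ⊕-cancelʳ : (x y z : Fin n) → x ⊕ z ≡ y ⊕ z → x ≡ y
  ⊕-cancelʳ x y z = ⟨$⟩ʳ-injective (rotation z)

-- Sums over Fin n

-- The least nonnegative representative, taken in `ℤ` so that congruence modulo `n` becomes
-- divisibility of a difference.
ι : Fin n → ℤ
ι i = + toℕ i

sq : ℤ → ℤ
sq x = x ℤ.* x

ι-⊕ : .{{_ : NonZero n}} (x y : Fin n) → + n ℤ.∣ ι (x ⊕ y) ℤ.- (ι x ℤ.+ ι y)
ι-⊕ {n} x y = divides (ℤ.- + q) (begin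
  ι (x ⊕ y) ℤ.- (ι x ℤ.+ ι y)                      ≡⟨ cong (ℤ._- (ι x ℤ.+ ι y)) (cong +_ (toℕ-⊕ x y)) ⟩
  + r ℤ.- + (toℕ x + toℕ y)                        ≡⟨ cong (λ s → + r ℤ.- + s) (m≡m%n+[m/n]*n (toℕ x + toℕ y) n) ⟩
  + r ℤ.- (+ r ℤ.+ + (q * n))                      ≡⟨ cong (λ s → + r ℤ.- (+ r ℤ.+ s)) (ℤ.pos-* q n) ⟩
  + r ℤ.- (+ r ℤ.+ + q ℤ.* + n)                    ≡⟨ identity (+ r) (+ q) (+ n) ⟩
  ℤ.- + q ℤ.* + n                                  ∎)
  where
  open ≡-Reasoning
  r = (toℕ x + toℕ y) % n
  q = (toℕ x + toℕ y) / n
  identity : ∀ r q n → r ℤ.- (r ℤ.+ q ℤ.* n) ≡ ℤ.- q ℤ.* n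
  identity = solve-∀

∑-mod : ∀ d {f g : Fin n → ℤ} → (∀ i → d ℤ.∣ f i ℤ.- g i) → d ℤ.∣ sum f ℤ.- sum g
∑-mod {zero}  d         d∣f-g = divides (+ 0) refl
∑-mod {suc n} d {f} {g} d∣f-g = subst (d ℤ.∣_)
  (identity (f zero) (g zero) (sum (f ∘ suc)) (sum (g ∘ suc)))
  (ℤ.∣m∣n⇒∣m+n (d∣f-g zero) (∑-mod d (d∣f-g ∘ suc)))
  where
  identity : ∀ a b c d → (a ℤ.- b) ℤ.+ (c ℤ.- d) ≡ (a ℤ.+ c) ℤ.- (b ℤ.+ d)
  identity = solve-∀

-- An injective self-map of `Fin n` is a permutation, so it only reorders the summands.
∑-injective : (h : Fin n → ℤ) {f : Fin n → Fin n} → Injective _≡_ _≡_ f → sum (h ∘ f) ≡ sum h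
∑-injective h {f} inj = sym (∑-permute h (injective⇒permutation f inj))

∑-ι-suc : ∀ n (h : ℤ → ℤ) → ∑[ i < suc n ] h (ι i) ≡ ∑[ i < n ] h (ι i) ℤ.+ h (+ n)
∑-ι-suc n h = trans (sum-init-last {n} (h ∘ ι)) (cong₂ ℤ._+_
  (sum-cong-≗ {n} (λ i → cong (h ∘ +_) (toℕ-inject₁ i)))
  (cong (h ∘ +_) (toℕ-fromℕ n)))

∑-ι : ∀ n → sum {n} ι ℤ.* + 2 ≡ + n ℤ.* (+ n ℤ.- + 1)
∑-ι zero    = refl
∑-ι (suc n) = begin
  sum {suc n} ι ℤ.* + 2                        ≡⟨ cong (ℤ._* + 2) (∑-ι-suc n (λ x → x)) ⟩
  (sum {n} ι ℤ.+ + n) ℤ.* + 2                  ≡⟨ ℤ.*-distribʳ-+ (+ 2) (sum {n} ι) (+ n) ⟩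
  sum {n} ι ℤ.* + 2 ℤ.+ + n ℤ.* + 2            ≡⟨ cong (ℤ._+ + n ℤ.* + 2) (∑-ι n) ⟩
  + n ℤ.* (+ n ℤ.- + 1) ℤ.+ + n ℤ.* + 2        ≡⟨ identity (+ n) ⟩
  (+ 1 ℤ.+ + n) ℤ.* (+ 1 ℤ.+ + n ℤ.- + 1)      ∎
  where
  open ≡-Reasoning
  identity : ∀ n → n ℤ.* (n ℤ.- + 1) ℤ.+ n ℤ.* + 2 ≡ (+ 1 ℤ.+ n) ℤ.* (+ 1 ℤ.+ n ℤ.- + 1)
  identity = solve-∀

-- The factor 6 clears the denominator of the closed form for a sum of squares.
∑-sq-ι : ∀ n → sum {n} (sq ∘ ι) ℤ.* + 6 ≡ + n ℤ.* ((+ n ℤ.- + 1) ℤ.* (+ 2 ℤ.* + n ℤ.- + 1))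
∑-sq-ι zero    = refl
∑-sq-ι (suc n) = begin
  sum {suc n} (sq ∘ ι) ℤ.* + 6                             ≡⟨ cong (ℤ._* + 6) (∑-ι-suc n sq) ⟩
  (sum {n} (sq ∘ ι) ℤ.+ sq (+ n)) ℤ.* + 6                  ≡⟨ ℤ.*-distribʳ-+ (+ 6) (sum {n} (sq ∘ ι)) (sq (+ n)) ⟩
  sum {n} (sq ∘ ι) ℤ.* + 6 ℤ.+ sq (+ n) ℤ.* + 6            ≡⟨ cong (ℤ._+ sq (+ n) ℤ.* + 6) (∑-sq-ι n) ⟩
  + n ℤ.* ((+ n ℤ.- + 1) ℤ.* (+ 2 ℤ.* + n ℤ.- + 1)) ℤ.+ sq (+ n) ℤ.* + 6
                                                           ≡⟨ identity (+ n) ⟩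
  (+ 1 ℤ.+ + n) ℤ.* ((+ 1 ℤ.+ + n ℤ.- + 1) ℤ.* (+ 2 ℤ.* (+ 1 ℤ.+ + n) ℤ.- + 1)) ∎
  where
  open ≡-Reasoning
  identity : ∀ n → n ℤ.* ((n ℤ.- + 1) ℤ.* (+ 2 ℤ.* n ℤ.- + 1)) ℤ.+ n ℤ.* n ℤ.* + 6 ≡
                   (+ 1 ℤ.+ n) ℤ.* ((+ 1 ℤ.+ n ℤ.- + 1) ℤ.* (+ 2 ℤ.* (+ 1 ℤ.+ n) ℤ.- + 1))
  identity = solve-∀

2∣n⇒n∤∑ι : .{{_ : NonZero n}} → 2 ∣ n → ¬ (+ n ℤ.∣ sum {n} ι)
2∣n⇒n∤∑ι {n} 2∣n n∣∑ = from-no (2 ∣? 1) (ℤ.∣⇒∣ᵤ 2∣1)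
  where
  2∣n-1 : + 2 ℤ.∣ + n ℤ.- + 1
  -- Doubling the assumption gives `2n ∣ n(n − 1)`, and the nonzero `n` cancels.
  2∣n-1 = ℤ.*-cancelˡ-∣ (+ n) (subst (+ n ℤ.* + 2 ℤ.∣_) (∑-ι n) (ℤ.*-monoˡ-∣ (+ 2) n∣∑))
  identity : ∀ n → n ℤ.- (n ℤ.- + 1) ≡ + 1
  identity = solve-∀
  2∣1 : + 2 ℤ.∣ + 1
  2∣1 = subst (+ 2 ℤ.∣_) (identity (+ n)) (ℤ.∣m∣n⇒∣m-n (ℤ.∣ᵤ⇒∣ {+ 2} {+ n} 2∣n) 2∣n-1)

3∣n⇒n∤2∑sqι : .{{_ : NonZero n}} → 3 ∣ n → ¬ (+ n ℤ.∣ sum {n} (sq ∘ ι) ℤ.* + 2)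
3∣n⇒n∤2∑sqι {n} 3∣n n∣2∑ = from-no (3 ∣? 1) (ℤ.∣⇒∣ᵤ 3∣1)
  where
  3∣product : + 3 ℤ.∣ (+ n ℤ.- + 1) ℤ.* (+ 2 ℤ.* + n ℤ.- + 1)
  -- Tripling the assumption gives `3n ∣ n(n − 1)(2n − 1)`; after cancelling `n`, the remaining
  -- product is 1 modulo 3.
  3∣product = ℤ.*-cancelˡ-∣ (+ n) (subst (+ n ℤ.* + 3 ℤ.∣_)
    (trans (ℤ.*-assoc (sum {n} (sq ∘ ι)) (+ 2) (+ 3)) (∑-sq-ι n)) (ℤ.*-monoˡ-∣ (+ 3) n∣2∑))
  identity : ∀ n → (n ℤ.- + 1) ℤ.* (+ 2 ℤ.* n ℤ.- + 1) ℤ.- n ℤ.* (+ 2 ℤ.* n ℤ.- + 3) ≡ + 1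
  identity = solve-∀
  3∣1 : + 3 ℤ.∣ + 1
  3∣1 = subst (+ 3 ℤ.∣_) (identity (+ n))
    (ℤ.∣m∣n⇒∣m-n 3∣product (ℤ.∣m⇒∣m*n (+ 2 ℤ.* + n ℤ.- + 3) (ℤ.∣ᵤ⇒∣ {+ 3} {+ n} 3∣n)))

-- Differences and totals of a permutation

module _ .{{_ : NonZero n}} (π : Permutation′ n) where

  difference total : Fin n → Fin n
  difference y = y ⊖ (π ⟨$⟩ʳ y)
  total      y = y ⊕ (π ⟨$⟩ʳ y)

  πy⊕difference : ∀ y → (π ⟨$⟩ʳ y) ⊕ difference y ≡ y
  πy⊕difference y = trans (⊕-comm (π ⟨$⟩ʳ y) (difference y)) ([x⊖y]⊕y≡x y (π ⟨$⟩ʳ y))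

  private
    ι-difference : ∀ y → + n ℤ.∣ ι y ℤ.- (ι (π ⟨$⟩ʳ y) ℤ.+ ι (difference y))
    ι-difference y = subst (λ z → + n ℤ.∣ ι z ℤ.- (ι (π ⟨$⟩ʳ y) ℤ.+ ι (difference y)))
      (πy⊕difference y) (ι-⊕ (π ⟨$⟩ʳ y) (difference y))

  difference-injective⇒n∣∑ι : Injective _≡_ _≡_ difference → + n ℤ.∣ sum {n} ι
  difference-injective⇒n∣∑ι inj = subst (+ n ℤ.∣_) (begin
    ℤ.- (P ℤ.- ∑[ y < n ] (ι (π ⟨$⟩ʳ y) ℤ.+ ι (difference y)))
      ≡⟨ cong (λ s → ℤ.- (P ℤ.- s)) (∑-distrib-+ (ι ∘ (π ⟨$⟩ʳ_)) (ι ∘ difference)) ⟩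
    ℤ.- (P ℤ.- (sum (ι ∘ (π ⟨$⟩ʳ_)) ℤ.+ sum (ι ∘ difference)))
      ≡⟨ cong₂ (λ s s′ → ℤ.- (P ℤ.- (s ℤ.+ s′))) (∑-injective ι (⟨$⟩ʳ-injective π)) (∑-injective ι inj) ⟩
    -- Summing `y ≡ π y + d y` over all `y` yields `P ≡ P + P`, since all three terms run over the
    -- whole of `Fin n`.
    ℤ.- (P ℤ.- (P ℤ.+ P))
      ≡⟨ identity P ⟩
    P ∎)
    (ℤ.∣m⇒∣-m (∑-mod (+ n) ι-difference))
    where
    open ≡-Reasoning
    P = sum {n} ι
    identity : ∀ p → ℤ.- (p ℤ.- (p ℤ.+ p)) ≡ p
    identity = solve-∀

  difference-total-injective⇒n∣2∑sqι : Injective _≡_ _≡_ difference → Injective _≡_ _≡_ total →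
                                       + n ℤ.∣ sum {n} (sq ∘ ι) ℤ.* + 2
  difference-total-injective⇒n∣2∑sqι d-inj s-inj = subst (+ n ℤ.∣_) (begin
    ℤ.- (sum f ℤ.- sum g)                                  ≡⟨ cong₂ (λ s s′ → ℤ.- (s ℤ.- s′)) ∑f ∑g ⟩
    -- The summed congruence reads `2Q ≡ 4Q`.
    ℤ.- ((Q ℤ.+ Q) ℤ.- ((Q ℤ.+ Q) ℤ.+ (Q ℤ.+ Q)))          ≡⟨ identity Q ⟩
    Q ℤ.* + 2                                              ∎)
    (ℤ.∣m⇒∣-m (∑-mod (+ n) {f} {g} n∣f-g))
    where
    open ≡-Reasoning
    Q = sum {n} (sq ∘ ι)
    identity : ∀ q → ℤ.- ((q ℤ.+ q) ℤ.- ((q ℤ.+ q) ℤ.+ (q ℤ.+ q))) ≡ q ℤ.* + 2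
    identity = solve-∀

    f g d² s² y² p² : Fin n → ℤ
    d² = sq ∘ ι ∘ difference
    s² = sq ∘ ι ∘ total
    y² = sq ∘ ι
    p² = sq ∘ ι ∘ (π ⟨$⟩ʳ_)
    f y = d² y ℤ.+ s² y
    g y = (y² y ℤ.+ y² y) ℤ.+ (p² y ℤ.+ p² y)

    ∑p² : sum p² ≡ Q
    ∑p² = ∑-injective (sq ∘ ι) (⟨$⟩ʳ-injective π)

    ∑f : sum f ≡ Q ℤ.+ Q
    ∑f = trans (∑-distrib-+ d² s²) (cong₂ ℤ._+_ (∑-injective (sq ∘ ι) d-inj) (∑-injective (sq ∘ ι) s-inj))

    ∑g : sum g ≡ (Q ℤ.+ Q) ℤ.+ (Q ℤ.+ Q)
    ∑g = trans (∑-distrib-+ (λ y → y² y ℤ.+ y² y) (λ y → p² y ℤ.+ p² y)) (cong₂ ℤ._+_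
      (∑-distrib-+ y² y²)
      (trans (∑-distrib-+ p² p²) (cong₂ ℤ._+_ ∑p² ∑p²)))

    -- The two products are `d² − (y − p)²` and `s² − (y + p)²`; the first factor of each vanishes
    -- modulo `n` by the definition of `d` and `s`.
    factorisation : ∀ y p d s →
      (y ℤ.- (p ℤ.+ d)) ℤ.* (p ℤ.- y ℤ.- d) ℤ.+ (s ℤ.- (y ℤ.+ p)) ℤ.* (s ℤ.+ (y ℤ.+ p)) ≡
      (d ℤ.* d ℤ.+ s ℤ.* s) ℤ.- ((y ℤ.* y ℤ.+ y ℤ.* y) ℤ.+ (p ℤ.* p ℤ.+ p ℤ.* p))
    factorisation = solve-∀

    n∣f-g : ∀ y → + n ℤ.∣ f y ℤ.- g y
    n∣f-g y = subst (+ n ℤ.∣_) (factorisation (ι y) (ι (π ⟨$⟩ʳ y)) (ι (difference y)) (ι (total y)))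
      (ℤ.∣m∣n⇒∣m+n (ℤ.∣m⇒∣m*n _ (ι-difference y)) (ℤ.∣m⇒∣m*n _ (ι-⊕ y (π ⟨$⟩ʳ y))))

  -- Shifting `π y` by `y − π y` reaches `y`, which `π` sends back to `π y`.
  difference-fixedPoint : ∀ y {b} → difference y ≡ b → rotation b ∘ₚ π ⟨$⟩ʳ (π ⟨$⟩ʳ y) ≡ π ⟨$⟩ʳ y
  difference-fixedPoint y refl = cong (π ⟨$⟩ʳ_) (πy⊕difference y)

  -- Shifts with at least three cycles

  module _ (4≤n : 4 ≤ n) where

    difference-collision : ∀ {y y′} → y ≢ y′ → difference y ≡ difference y′ →
                           ∃[ b ] 3 ≤ cyc (rotation b ∘ₚ π)
    difference-collision {y} {y′} y≢y′ eq = difference y′ ,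
      three-cycles (rotation (difference y′) ∘ₚ π) 4≤n (difference-fixedPoint y eq) (difference-fixedPoint y eq)
        (difference-fixedPoint y′ refl) πy′≢πy πy′≢πy
      where
      πy′≢πy : π ⟨$⟩ʳ y′ ≢ π ⟨$⟩ʳ y
      πy′≢πy = y≢y′ ∘ sym ∘ ⟨$⟩ʳ-injective π

    total-collision : Injective _≡_ _≡_ difference → ∀ {y y′} → y ≢ y′ → total y ≡ total y′ →
                      ∃[ b ] 3 ≤ cyc (rotation b ∘ₚ π)
    total-collision inj {y} {y′} y≢y′ eq = b ,
      three-cycles (rotation b ∘ₚ π) 4≤n (cong (π ⟨$⟩ʳ_) πy⊕b≡y′) (cong (π ⟨$⟩ʳ_) πy′⊕b≡y)
        (difference-fixedPoint z dz≡b) πz≢πy πz≢πy′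
      where
      open ≡-Reasoning
      p  = π ⟨$⟩ʳ y
      p′ = π ⟨$⟩ʳ y′
      -- This shift takes `π y` to `y′`; equality of the totals makes it take `π y′` to `y` as well.
      b  = y′ ⊖ p
      -- Surjectivity of `difference` provides a fixed point `π z` for this same shift.
      z  = proj₁ (injective⇒surjective inj b)
      dz≡b : difference z ≡ b
      dz≡b = proj₂ (injective⇒surjective inj b)

      πy⊕b≡y′ : p ⊕ b ≡ y′
      πy⊕b≡y′ = trans (⊕-comm p b) ([x⊖y]⊕y≡x y′ p)

      πy′⊕b≡y : p′ ⊕ b ≡ y
      πy′⊕b≡y = ⊕-cancelʳ (p′ ⊕ b) y p (begin
        p′ ⊕ b ⊕ p    ≡⟨ ⊕-rotate p′ b p ⟩
        b ⊕ p ⊕ p′    ≡⟨ cong (_⊕ p′) ([x⊖y]⊕y≡x y′ p) ⟩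
        y′ ⊕ p′       ≡⟨ eq ⟨
        y ⊕ p         ∎)

      πz⊕b≡z : (π ⟨$⟩ʳ z) ⊕ b ≡ z
      πz⊕b≡z = subst (λ c → (π ⟨$⟩ʳ z) ⊕ c ≡ z) dz≡b (πy⊕difference z)

      πz≢πy : π ⟨$⟩ʳ z ≢ p
      -- If `π z = π y`, then `z = y`, while shifting by `b` gives `z` on one side and `y′` on the
      -- other.
      πz≢πy e = y≢y′ (trans (sym (⟨$⟩ʳ-injective π e)) (trans (sym πz⊕b≡z) (trans (cong (_⊕ b) e) πy⊕b≡y′)))

      πz≢πy′ : π ⟨$⟩ʳ z ≢ p′
      πz≢πy′ e = y≢y′ (sym (trans (sym (⟨$⟩ʳ-injective π e)) (trans (sym πz⊕b≡z) (trans (cong (_⊕ b) e) πy′⊕b≡y))))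

    rotation-with-three-cycles : (2 ∣ n) ⊎ (3 ∣ n) → ∃[ b ] 3 ≤ cyc (rotation b ∘ₚ π)
    rotation-with-three-cycles 2∣n⊎3∣n with injective-or-collision difference
    ... | inj₂ (y , y′ , y≢y′ , eq) = difference-collision y≢y′ eq
    ... | inj₁ d-inj with injective-or-collision total
    ...   | inj₂ (y , y′ , y≢y′ , eq) = total-collision d-inj y≢y′ eq
    ...   | inj₁ s-inj = contradiction 2∣n⊎3∣n [
      (λ 2∣n → 2∣n⇒n∤∑ι 2∣n (difference-injective⇒n∣∑ι d-inj)) ,
      (λ 3∣n → 3∣n⇒n∤2∑sqι 3∣n (difference-total-injective⇒n∣2∑sqι d-inj s-inj)) ]

    t[]≤n∸3 : (2 ∣ n) ⊎ (3 ∣ n) → t[ π ] ≤ n ∸ 3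
    t[]≤n∸3 2∣n⊎3∣n with rotation-with-three-cycles 2∣n⊎3∣n
    ... | b , 3≤cyc = min≤v⁺ (tₚ π) _
      (inj₂ (Any.map⁺ (Any.map⁺ (lose (∈-allFin b) (∸-monoʳ-≤ n 3≤cyc)))))

theorem1p3 : (n : ℕ) .{{_ : NonZero n}} → 4 ≤ n → (2 ∣ n) ⊎ (3 ∣ n) → t n ≤ n ∸ 3
theorem1p3 n 4≤n 2∣n⊎3∣n =
  -- `z≤n` bounds the default value 0 of `max`; the other values are bounded class by class.
  max≤v⁺ z≤n (All.map⁺ (universal (λ π → t[]≤n∸3 π 4≤n 2∣n⊎3∣n) (permutations n)))
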